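{- Let $1 \le k \le n-1$ be integers and let $\mathcal{F}$ be a family of subsets of $[n] = \{1,\dots,n\}$, each of size at most $k$, with $\emptyset \notin \mathcal{F}$. Suppose that for every two sets $A, B \in \mathcal{F}$ with $A \cap B = \emptyset$ we have $|A| + |B| \le k$. Then $$|\mathcal{F}| \le \binom{n-1}{k-1} + \binom{n-1}{k-2} + \cdots + \binom{n-1}{0}.$$ -}

module Defs where

open import Data.Nat using (ℕ; zero; suc; _+_)
open import Data.Nat.Combinatorics using (_C_)

binomSumBelow : ℕ → ℕ → ℕ
binomSumBelow m zero = 0
binomSumBelow m (suc j) = (m C j) + binomSumBelow m j

{-# OPTIONS --safe #-}
-- Averaging over permutations (Katona's circle). Fix a cyclic order of [n] and
-- let α j be the number of arcs of length j whose point set lies in the family;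
-- weight an arc of length j by C(n, j). Averaged over all cyclic orders the
-- weighted number of arcs is n |F|, while ∑_{1≤j≤k} C(n, j) j = n ∑_{j<k} C(n-1, j),
-- so it suffices to show ∑ C(n, j) α j ≤ ∑ C(n, j) j on every single circle. There,
-- disjoint arcs give α a + α b ≤ a + b whenever k < a + b ≤ n and α a, α b > 0.
-- Call j excessive if α j > j. An excessive p ≤ n/2 satisfies 2p ≤ k and its excess
-- is covered by the deficit at k + 1 - p; an excessive p > n/2 is covered by n - p.
-- No deficit is used twice: k + 1 - p = n - p′ would give excessive p, p′ with
-- k < p + p′ ≤ n, hence α p + α p′ ≤ p + p′.
module Submission where

open import Defs
open import Data.Bool using (Bool; true; false; _∧_; if_then_else_)
import Data.Bool.Properties as Bool
open import Data.Empty using (⊥)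
open import Data.Fin using (Fin; zero; suc; toℕ)
open import Data.Fin.Subset using (Subset; ∣_∣; _∩_; Empty; Nonempty)
open import Data.Fin.Subset.Properties using (∣p∣≤n)
open import Data.List using (List; []; _∷_; _++_; length; map; downFrom; allFin; cartesianProductWith)
open import Data.List.Membership.Propositional using (_∈_)
open import Data.List.Membership.Propositional.Properties using (∈-downFrom⁻; ∈-downFrom⁺; ∈-map⁻)
open import Data.List.Properties using (map-++; map-∘; map-tabulate; length-tabulate; length-downFrom)
open import Data.List.Relation.Unary.All as All using (All)
open import Data.List.Relation.Unary.AllPairs using (_∷_)
open import Data.List.Relation.Unary.Any using (here; there)
open import Data.List.Relation.Unary.Unique.Propositional using (Unique)
import Data.List.Relation.Unary.Unique.Propositional.Properties as Unique
open import Data.Nat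
open import Data.Nat.Combinatorics
  using (_C_; nCk≡nC[n∸k]; nCk≡n!/k![n-k]!; nCn≡1; k>n⇒nCk≡0; k![n∸k]!∣n!; nCk+nC[k+1]≡[n+1]C[k+1])
open import Data.Nat.DivMod
  using (_%_; m/n*n≡m; m<n⇒m%n≡m; [m+n]%n≡m%n; %-distribˡ-+; m%n%n≡m%n)
open import Data.Nat.ListAction using (sum)
open import Data.Nat.ListAction.Properties using (sum-++)
open import Data.Nat.Properties
import Data.Nat.Solver
open Data.Nat.Solver.+-*-Solver using (solve; _:+_; _:*_; _:=_)
open import Data.Product using (∃; _×_; _,_; proj₂)
open import Data.Sum using (_⊎_; inj₁; inj₂)
open import Data.Vec using (Vec; []; _∷_; _[_]=_; here; there; insertAt; removeAt; lookup; tabulate)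
open import Data.Vec.Properties using (removeAt-insertAt; insertAt-removeAt; insertAt-lookup; tabulate-cong)
open import Function using (_∘_; id)
open import Relation.Binary.PropositionalEquality
open import Relation.Nullary using (yes; no; does; contradiction)
open import Relation.Nullary.Reflects using (ofʸ; ofⁿ)

private
  variable
    X Y : Set
    n : ℕ

-- Finite sums over lists and over initial segments.

∑ : List X → (X → ℕ) → ℕ
∑ xs f = sum (map f xs)

∑< : ℕ → (ℕ → ℕ) → ℕ
∑< n = ∑ (downFrom n)

∑-mono : {f g : X → ℕ} (xs : List X) → (∀ {x} → x ∈ xs → f x ≤ g x) → ∑ xs f ≤ ∑ xs g
∑-mono []       h = z≤n
∑-mono (x ∷ xs) h = +-mono-≤ (h (here refl)) (∑-mono xs (h ∘ there))

∑-cong : {f g : X → ℕ} (xs : List X) → (∀ {x} → x ∈ xs → f x ≡ g x) → ∑ xs f ≡ ∑ xs g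
∑-cong xs h = ≤-antisym (∑-mono xs (≤-reflexive ∘ h)) (∑-mono xs (≤-reflexive ∘ sym ∘ h))

∑-const : (xs : List X) (c : ℕ) → ∑ xs (λ _ → c) ≡ length xs * c
∑-const []       c = refl
∑-const (x ∷ xs) c = cong (c +_) (∑-const xs c)

∑-0 : {f : X → ℕ} (xs : List X) → (∀ {x} → x ∈ xs → f x ≡ 0) → ∑ xs f ≡ 0
∑-0 xs h = trans (∑-cong xs h) (trans (∑-const xs 0) (*-zeroʳ (length xs)))

∑-distrib-+ : (xs : List X) (f g : X → ℕ) → ∑ xs (λ x → f x + g x) ≡ ∑ xs f + ∑ xs g
∑-distrib-+ []       f g = refl
∑-distrib-+ (x ∷ xs) f g = trans (cong (f x + g x +_) (∑-distrib-+ xs f g))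
  (solve 4 (λ a b c d → a :+ b :+ (c :+ d) := a :+ c :+ (b :+ d)) refl (f x) (g x) (∑ xs f) (∑ xs g))

*-distribˡ-∑ : (xs : List X) (c : ℕ) (f : X → ℕ) → c * ∑ xs f ≡ ∑ xs (λ x → c * f x)
*-distribˡ-∑ []       c f = *-zeroʳ c
*-distribˡ-∑ (x ∷ xs) c f = trans (*-distribˡ-+ c (f x) _) (cong (c * f x +_) (*-distribˡ-∑ xs c f))

∑-comm : (xs : List X) (ys : List Y) (f : X → Y → ℕ) →
  ∑ xs (λ x → ∑ ys (f x)) ≡ ∑ ys (λ y → ∑ xs (λ x → f x y))
∑-comm []       ys f = sym (∑-0 ys (λ _ → refl))
∑-comm (x ∷ xs) ys f = trans (cong (∑ ys (f x) +_) (∑-comm xs ys f))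
  (sym (∑-distrib-+ ys (f x) (λ y → ∑ xs (λ x → f x y))))

∑-map : (xs : List X) (h : X → Y) (f : Y → ℕ) → ∑ (map h xs) f ≡ ∑ xs (f ∘ h)
∑-map xs h f = cong sum (sym (map-∘ xs))

∑-cartesianProductWith : {Z : Set} (h : X → Y → Z) (xs : List X) (ys : List Y) (f : Z → ℕ) →
  ∑ (cartesianProductWith h xs ys) f ≡ ∑ xs (λ x → ∑ ys (f ∘ h x))
∑-cartesianProductWith h []       ys f = refl
∑-cartesianProductWith h (x ∷ xs) ys f = begin
  sum (map f (map (h x) ys ++ zs))  ≡⟨ cong sum (map-++ f (map (h x) ys) zs) ⟩
  sum (map f (map (h x) ys) ++ _)   ≡⟨ sum-++ (map f (map (h x) ys)) _ ⟩
  ∑ (map (h x) ys) f + ∑ zs f       ≡⟨ cong₂ _+_ (∑-map ys (h x) f) (∑-cartesianProductWith h xs ys f) ⟩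
  ∑ ys (f ∘ h x) + _                ∎
  where
  open ≡-Reasoning
  zs = cartesianProductWith h xs ys

∑-term : (xs : List X) (f : X → ℕ) {x : X} → x ∈ xs → f x ≤ ∑ xs f
∑-term (x ∷ xs) f (here refl) = m≤m+n _ _
∑-term (x ∷ xs) f (there p)   = ≤-trans (∑-term xs f p) (m≤n+m _ (f x))

∑-positive : (xs : List X) (f : X → ℕ) → 0 < ∑ xs f → ∃ λ x → x ∈ xs × 0 < f x
∑-positive (x ∷ xs) f p with f x in eq
... | suc _ = x , here refl , subst (0 <_) (sym eq) z<s
... | zero with ∑-positive xs f p
...   | y , y∈xs , fy>0 = y , there y∈xs , fy>0

∑<-bottom : ∀ n (f : ℕ → ℕ) → ∑< (suc n) f ≡ f 0 + ∑< n (f ∘ suc)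
∑<-bottom zero    f = refl
∑<-bottom (suc n) f = trans (cong (f (suc n) +_) (∑<-bottom n f))
  (solve 3 (λ a b c → a :+ (b :+ c) := b :+ (a :+ c)) refl (f (suc n)) (f 0) _)

∑<-reverse : ∀ n (f : ℕ → ℕ) → ∑< n f ≡ ∑< n (λ i → f (n ∸ suc i))
∑<-reverse zero    f = refl
∑<-reverse (suc n) f = trans (cong (f n +_) (∑<-reverse n f))
  (sym (∑<-bottom n (λ i → f (n ∸ i))))

∑<-split : ∀ d e (f : ℕ → ℕ) → ∑< (e + d) f ≡ ∑< e (λ i → f (i + d)) + ∑< d f
∑<-split d zero    f = refl
∑<-split d (suc e) f = trans (cong (f (e + d) +_) (∑<-split d e f)) (sym (+-assoc (f (e + d)) _ _))

-- Advancing the window by one drops `f s` and gains `f (n + s)`, which agree by periodicity.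
∑<-window : ∀ n (f : ℕ → ℕ) → (∀ i → f (i + n) ≡ f i) → ∀ s → ∑< n (λ i → f (i + s)) ≡ ∑< n f
∑<-window n f per zero    = ∑-cong (downFrom n) (λ {i} _ → cong f (+-identityʳ i))
∑<-window n f per (suc s) = begin
  ∑< n (λ i → f (i + suc s))   ≡⟨ ∑-cong (downFrom n) (λ {i} _ → cong f (+-suc i s)) ⟩
  ∑< n (λ i → f (suc i + s))   ≡⟨ +-cancelˡ-≡ (f s) _ _ lemma ⟩
  ∑< n (λ i → f (i + s))       ≡⟨ ∑<-window n f per s ⟩
  ∑< n f                       ∎
  where
  open ≡-Reasoning
  lemma : f s + ∑< n (λ i → f (suc i + s)) ≡ f s + ∑< n (λ i → f (i + s))
  lemma = begin
    f s + ∑< n (λ i → f (suc i + s))    ≡⟨ ∑<-bottom n (λ i → f (i + s)) ⟨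
    f (n + s) + ∑< n (λ i → f (i + s))
      ≡⟨ cong (_+ ∑< n (λ i → f (i + s))) (trans (cong f (+-comm n s)) (per s)) ⟩
    f s + ∑< n (λ i → f (i + s))        ∎

-- Mutual exclusion of two periodic 0/1 sequences.

∑<-01 : ∀ m r (h : ℕ → ℕ) → (∀ i → h i ≤ 1) → (∀ {i} → i < m → h i ≡ 0) → ∑< (r + m) h ≤ r
∑<-01 m zero    h h≤1 h≡0 = ≤-reflexive (∑-0 (downFrom m) (h≡0 ∘ ∈-downFrom⁻))
∑<-01 m (suc r) h h≤1 h≡0 = +-mono-≤ (h≤1 (r + m)) (∑<-01 m r h h≤1 h≡0)

-- With `h j = f (j + t)` this finds the last position occupied by `f` in one full turn starting at
-- `t`.
lastPositive : ∀ e (h : ℕ → ℕ) → (∀ {j} → j < e → h j ≡ 0) ⊎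
  ∃ λ j → j < e × 0 < h j × (∀ {i} → j < i → i < e → h i ≡ 0)
lastPositive zero    h = inj₁ (λ ())
lastPositive (suc e) h with h e in eq
... | suc _ = inj₂ (e , n<1+n e , subst (0 <_) (sym eq) z<s ,
                    λ e<i i<1+e → contradiction (s≤s⁻¹ i<1+e) (<⇒≱ e<i))
... | zero with lastPositive e h
...   | inj₁ none = inj₁ λ {j} j<1+e → case (m≤n⇒m<n∨m≡n (s≤s⁻¹ j<1+e))
  where
  case : ∀ {j} → j < e ⊎ j ≡ e → h j ≡ 0
  case (inj₁ j<e)  = none j<e
  case (inj₂ refl) = eq
...   | inj₂ (j , j<e , hj>0 , after) = inj₂ (j , m<n⇒m<1+n j<e , hj>0 ,
          λ {i} j<i i<1+e → case j<i (m≤n⇒m<n∨m≡n (s≤s⁻¹ i<1+e)))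
  where
  case : ∀ {i} → j < i → i < e ⊎ i ≡ e → h i ≡ 0
  case j<i (inj₁ i<e)  = after j<i i<e
  case j<i (inj₂ refl) = eq

n≡0⊎n>0 : ∀ {x} → x ≡ 0 ⊎ 0 < x
n≡0⊎n>0 {zero}  = inj₁ refl
n≡0⊎n>0 {suc x} = inj₂ z<s

-- For arcs of lengths `a` and `b`, `r` is `a + b` and `m` is the room left on the circle; `f` and
-- `g` mark which arcs lie in the family. Both `i = 0` and `i = m` are included, so `excl` clears
-- `m + 1` positions.
module _ {N m r : ℕ} (r+m≡N : r + m ≡ N) (f g : ℕ → ℕ) (f≤1 : ∀ i → f i ≤ 1) (g≤1 : ∀ i → g i ≤ 1)
         (f-per : ∀ i → f (i + N) ≡ f i) (g-per : ∀ i → g (i + N) ≡ g i)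
         (excl : ∀ s i → i ≤ m → 0 < f s → g (i + s) ≡ 0) where

  -- Offset `0` in `excl`: a position occupied by `f` is free of `g`.
  f+g≤1 : ∀ i → f i + g i ≤ 1
  f+g≤1 i with n≡0⊎n>0 {f i}
  ... | inj₁ fi≡0 = subst (λ z → z + g i ≤ 1) (sym fi≡0) (g≤1 i)
  ... | inj₂ fi>0 = subst (λ z → f i + z ≤ 1) (sym (excl i 0 z≤n fi>0))
                          (subst (_≤ 1) (sym (+-identityʳ (f i))) (f≤1 i))

  -- Take the last s before a point t of g with f s > 0: the m positions after s
  -- meet neither f (s is last) nor g (excl), and t forces m < t - s.
  crossing : ∑< N f ≡ 0 ⊎ ∑< N g ≡ 0 ⊎ ∑< N f + ∑< N g ≤ r
  crossing with n≡0⊎n>0 {∑< N g}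
  ... | inj₁ g≡0 = inj₂ (inj₁ g≡0)
  ... | inj₂ g>0 with ∑-positive (downFrom N) g g>0
  ...   | t , _ , gt>0 with lastPositive N (λ j → f (j + t))
  ...     | inj₁ none = inj₁ (trans (sym (∑<-window N f f-per t)) (∑-0 (downFrom N) (none ∘ ∈-downFrom⁻)))
  ...     | inj₂ (j , j<N , fj>0 , after) = inj₂ (inj₂ bound)
    where
    -- `s = j + t` is not before `t`, so the copy of `t` that follows it is `t + N`, at distance
    -- `N ∸ j`.
    m<N∸j : m < N ∸ j
    m<N∸j = ≰⇒> λ N∸j≤m → <⇒≢ gt>0 (sym (begin
      g t                    ≡⟨ g-per t ⟨
      g (t + N)              ≡⟨ cong g (+-comm t N) ⟩
      g (N + t)              ≡⟨ cong (λ z → g (z + t)) (m∸n+n≡m (<⇒≤ j<N)) ⟨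
      g (N ∸ j + j + t)      ≡⟨ cong g (+-assoc (N ∸ j) j t) ⟩
      g (N ∸ j + (j + t))    ≡⟨ excl (j + t) (N ∸ j) N∸j≤m fj>0 ⟩
      0                      ∎))
      where open ≡-Reasoning
    -- Starting the window right after `s` puts the `m` empty positions at its bottom, as `∑<-01`
    -- expects.
    s₀ = suc (j + t)
    h : ℕ → ℕ
    h i = f (i + s₀) + g (i + s₀)
    h≡0 : ∀ {i} → i < m → h i ≡ 0
    h≡0 {i} i<m = cong₂ _+_
      (trans (cong f (trans (+-suc i (j + t)) (sym (+-assoc (suc i) j t))))
             (after (m<n+m j z<s) (x+j<N (≤-<-trans i<m m<N∸j))))
      (trans (cong g (+-suc i (j + t))) (excl (j + t) (suc i) i<m fj>0))
      where
      x+j<N : ∀ {x} → x < N ∸ j → x + j < N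
      x+j<N {x} p = subst (x + j <_) (m∸n+n≡m (<⇒≤ j<N)) (+-monoˡ-< j p)
    bound : ∑< N f + ∑< N g ≤ r
    bound = begin
      ∑< N f + ∑< N g
        ≡⟨ cong₂ _+_ (∑<-window N f f-per s₀) (∑<-window N g g-per s₀) ⟨
      ∑< N (λ i → f (i + s₀)) + ∑< N (λ i → g (i + s₀))
        ≡⟨ ∑-distrib-+ (downFrom N) _ _ ⟨
      ∑< N h
        ≡⟨ cong (λ z → ∑< z h) r+m≡N ⟨
      ∑< (r + m) h
        ≤⟨ ∑<-01 m r h (λ i → f+g≤1 (i + s₀)) h≡0 ⟩
      r ∎
      where open ≤-Reasoning

-- Binomial coefficients and truncated subtraction.

nC0≡1 : ∀ n → n C 0 ≡ 1
nC0≡1 n = trans (nCk≡nC[n∸k] {0} {n} z≤n) (nCn≡1 n)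

-- Pascal's rule reduces `suc m` to `m`, except when `p + q = suc m`: there the side condition would
-- fail for `m`, and symmetry gives equality.
C-mono : ∀ m {p q} → p ≤ q → p + q ≤ m → m C p ≤ m C q
C-mono zero    {zero} {zero} _ _ = ≤-refl
C-mono (suc m) {p} {q} p≤q p+q≤ with m≤n⇒m<n∨m≡n p+q≤
... | inj₂ p+q≡ = ≤-reflexive (trans (nCk≡nC[n∸k] (≤-trans (m≤m+n p q) p+q≤))
        (cong (suc m C_) (trans (cong (_∸ p) (sym p+q≡)) (m+n∸m≡n p q))))
C-mono (suc m) {zero} {zero} _ _ | inj₁ _ = ≤-refl
C-mono (suc m) {zero} {suc q} _ _ | inj₁ (s≤s q≤m) = begin
  suc m C 0            ≡⟨ trans (nC0≡1 (suc m)) (sym (nC0≡1 m)) ⟩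
  m C 0                ≤⟨ C-mono m z≤n q≤m ⟩
  m C suc q            ≤⟨ m≤n+m _ _ ⟩
  m C q + m C suc q    ≡⟨ nCk+nC[k+1]≡[n+1]C[k+1] m q ⟩
  suc m C suc q        ∎
  where open ≤-Reasoning
C-mono (suc m) {suc p} {suc q} (s≤s p≤q) _ | inj₁ (s≤s p+q<m) = begin
  suc m C suc p        ≡⟨ nCk+nC[k+1]≡[n+1]C[k+1] m p ⟨
  m C p + m C suc p    ≤⟨ +-mono-≤ (C-mono m p≤q (≤-trans (+-mono-≤ (n≤1+n p) (n≤1+n q)) p+q<m))
                                   (C-mono m (s≤s p≤q) p+q<m) ⟩
  m C q + m C suc q    ≡⟨ nCk+nC[k+1]≡[n+1]C[k+1] m q ⟩
  suc m C suc q        ∎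
  where open ≤-Reasoning

nCk*k![n∸k]!≡n! : ∀ {n k} → k ≤ n → (n C k) * (k ! * (n ∸ k) !) ≡ n !
nCk*k![n∸k]!≡n! {n} {k} k≤n =
  trans (cong (_* (k ! * (n ∸ k) !)) (nCk≡n!/k![n-k]! k≤n)) (m/n*n≡m (k![n∸k]!∣n! k≤n))
  where instance _ = k !* (n ∸ k) !≢0

-- Absorption identity: multiplied by `j ! * (m ∸ j) !`, both sides become `suc m !`. For `j > m`
-- both vanish.
[1+j]*[1+m]C[1+j] : ∀ m j → suc j * (suc m C suc j) ≡ suc m * (m C j)
[1+j]*[1+m]C[1+j] m j with j ≤? m
... | no j≰m = trans (cong (suc j *_) (k>n⇒nCk≡0 (s<s (≰⇒> j≰m))))
  (trans (*-zeroʳ j) (sym (trans (cong (suc m *_) (k>n⇒nCk≡0 (≰⇒> j≰m))) (*-zeroʳ m))))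
... | yes j≤m = *-cancelʳ-≡ _ _ (j ! * (m ∸ j) !) (begin
  suc j * (suc m C suc j) * (j ! * (m ∸ j) !)
    ≡⟨ solve 4 (λ a b c d → a :* b :* (c :* d) := b :* (a :* c :* d)) refl (suc j) (suc m C suc j) (j !) _ ⟩
  (suc m C suc j) * (suc j ! * (m ∸ j) !)
    ≡⟨ nCk*k![n∸k]!≡n! (s≤s j≤m) ⟩
  suc m !
    ≡⟨ cong (suc m *_) (nCk*k![n∸k]!≡n! j≤m) ⟨
  suc m * ((m C j) * (j ! * (m ∸ j) !))
    ≡⟨ *-assoc (suc m) (m C j) _ ⟨
  suc m * (m C j) * (j ! * (m ∸ j) !) ∎)
  where
  open ≡-Reasoning
  instance _ = j !* (m ∸ j) !≢0

-- Absorption at the complementary index, with symmetry applied before and after.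
[1+m]C[p]*[1+m∸p] : ∀ m {p} → p ≤ m → (suc m C p) * (suc m ∸ p) ≡ suc m * (m C p)
[1+m]C[p]*[1+m∸p] m {p} p≤m = begin
  (suc m C p) * (suc m ∸ p)               ≡⟨ cong (_* (suc m ∸ p)) (nCk≡nC[n∸k] (m≤n⇒m≤1+n p≤m)) ⟩
  (suc m C (suc m ∸ p)) * (suc m ∸ p)     ≡⟨ cong (λ z → (suc m C z) * z) (+-∸-assoc 1 p≤m) ⟩
  (suc m C suc (m ∸ p)) * suc (m ∸ p)     ≡⟨ *-comm (suc m C suc (m ∸ p)) _ ⟩
  suc (m ∸ p) * (suc m C suc (m ∸ p))     ≡⟨ [1+j]*[1+m]C[1+j] m (m ∸ p) ⟩
  suc m * (m C (m ∸ p))                   ≡⟨ cong (suc m *_) (nCk≡nC[n∸k] p≤m) ⟨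
  suc m * (m C p)                         ∎
  where open ≡-Reasoning

-- Both sides are the maximum of `m` and `n`.
m+[n∸m]≡n+[m∸n] : ∀ m n → m + (n ∸ m) ≡ n + (m ∸ n)
m+[n∸m]≡n+[m∸n] m n with ≤-total m n
... | inj₁ m≤n = trans (m+[n∸m]≡n m≤n) (sym (trans (cong (n +_) (m≤n⇒m∸n≡0 m≤n)) (+-identityʳ n)))
... | inj₂ n≤m = sym (trans (m+[n∸m]≡n n≤m) (sym (trans (cong (m +_) (m≤n⇒m∸n≡0 n≤m)) (+-identityʳ m))))

-- Turns a bound on `α p + α c` into a comparison of the unweighted excess at `p` with the
-- unweighted deficit at `c`.
a+b≤c+d⇒a∸c≤d∸b : ∀ {a b c d} → a + b ≤ c + d → a ∸ c ≤ d ∸ b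
a+b≤c+d⇒a∸c≤d∸b {a} {b} {c} {d} le with ≤-total c a
... | inj₂ a≤c = subst (_≤ d ∸ b) (sym (m≤n⇒m∸n≡0 a≤c)) z≤n
... | inj₁ c≤a = m+n≤o⇒m≤o∸n (a ∸ c) (+-cancelˡ-≤ c _ _ (begin
  c + (a ∸ c + b)   ≡⟨ +-assoc c (a ∸ c) b ⟨
  c + (a ∸ c) + b   ≡⟨ cong (_+ b) (m+[n∸m]≡n c≤a) ⟩
  a + b             ≤⟨ le ⟩
  c + d             ∎))
  where open ≤-Reasoning

-- The weighted inequality on a single circle.

module Circle (k d : ℕ) (α : ℕ → ℕ)
  (cross : ∀ a b → k < a + b → a + b ≤ suc (k + d) → α a ≡ 0 ⊎ α b ≡ 0 ⊎ α a + α b ≤ a + b)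
  (compl : ∀ a b → a + b ≡ suc (k + d) → α a + α b ≤ a + b)
  (α≤n : ∀ a → α a ≤ suc (k + d)) where

  private
    m N : ℕ
    m = k + d
    N = suc m
    -- The cut at `N / 2` decides the partner: `low p` is charged to `suc k ∸ p`, `high p` to
    -- `N ∸ p`. The default `0` lets both be summed over every index.
    excess deficit low high : ℕ → ℕ
    excess p = (N C p) * (α p ∸ p)
    deficit p = (N C p) * (p ∸ α p)
    low p = if p + p ≤ᵇ N then excess p else 0
    high p = if p + p ≤ᵇ N then 0 else excess p

    low-or-high : ∀ p → (p + p ≤ N × low p ≡ excess p × high p ≡ 0)
                      ⊎ (N < p + p × low p ≡ 0 × high p ≡ excess p)
    low-or-high p with p + p ≤ᵇ N | ≤ᵇ-reflects-≤ (p + p) N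
    ... | true  | ofʸ 2p≤n = inj₁ (2p≤n , refl , refl)
    ... | false | ofⁿ 2p≰n = inj₂ (≰⇒> 2p≰n , refl , refl)

    low+high : ∀ p → excess p ≡ low p + high p
    low+high p with low-or-high p
    ... | inj₁ (_ , low≡ , high≡) = sym (trans (cong₂ _+_ low≡ high≡) (+-identityʳ _))
    ... | inj₂ (_ , low≡ , high≡) = sym (cong₂ _+_ low≡ high≡)

    high≤excess : ∀ p → high p ≤ excess p
    high≤excess p = ≤-trans (m≤n+m _ (low p)) (≤-reflexive (sym (low+high p)))

    high≡0 : ∀ p → p + p ≤ N → high p ≡ 0
    high≡0 p 2p≤n with low-or-high p
    ... | inj₁ (_ , _ , high≡) = high≡
    ... | inj₂ (n<2p , _)      = contradiction 2p≤n (<⇒≱ n<2p)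

    excess≡0 : ∀ {p} → α p ≤ p → excess p ≡ 0
    excess≡0 {p} le = trans (cong ((N C p) *_) (m≤n⇒m∸n≡0 le)) (*-zeroʳ (N C p))

    -- Excess makes both counts positive, so `cross` leaves only the bound on their sum, which two
    -- excesses violate.
    not-both : ∀ {p q} → p < α p → q < α q → k < p + q → p + q ≤ N → ⊥
    not-both {p} {q} p< q< k< ≤n with cross p q k< ≤n
    ... | inj₁ α≡0 = <⇒≱ p< (≤-trans (≤-reflexive α≡0) z≤n)
    ... | inj₂ (inj₁ α≡0) = <⇒≱ q< (≤-trans (≤-reflexive α≡0) z≤n)
    ... | inj₂ (inj₂ le) = <⇒≱ (+-mono-< p< q<) le

    -- The weights agree by symmetry of binomial coefficients, and `compl` compares the unweighted
    -- parts.
    high≤deficit : ∀ p c → p + c ≡ N → high p ≤ deficit c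
    high≤deficit p c p+c≡n = ≤-trans (high≤excess p) (*-mono-≤
      (≤-reflexive (trans (nCk≡nC[n∸k] (subst (p ≤_) p+c≡n (m≤m+n p c)))
                          (cong (N C_) (trans (cong (_∸ p) (sym p+c≡n)) (m+n∸m≡n p c)))))
      (a+b≤c+d⇒a∸c≤d∸b {α p} {α c} {p} {c} (compl p c p+c≡n)))

    -- If α c = 0, the claim becomes C(N,p) (N-p) ≤ C(N,c) c, i.e. C(N-1,p) ≤ C(N-1,c-1).
    excess≤deficit : ∀ {p c} → p + c ≡ suc k → p < c → p < α p → excess p ≤ deficit c
    excess≤deficit {p} {suc c} p+c≡ p<c p<αp with cross p (suc c) (≤-reflexive (sym p+c≡)) (subst (_≤ N) (sym p+c≡) (s≤s (m≤m+n k d)))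
    ... | inj₁ α≡0 = contradiction (≤-trans (≤-reflexive α≡0) z≤n) (<⇒≱ p<αp)
    ... | inj₂ (inj₂ le) = *-mono-≤
            (C-mono N (<⇒≤ p<c) (subst (_≤ N) (sym p+c≡) (s≤s (m≤m+n k d))))
            (a+b≤c+d⇒a∸c≤d∸b {α p} {α (suc c)} {p} {suc c} le)
    ... | inj₂ (inj₁ α≡0) = begin
      (N C p) * (α p ∸ p)             ≤⟨ *-monoʳ-≤ (N C p) (∸-monoˡ-≤ p (α≤n p)) ⟩
      (N C p) * (N ∸ p)               ≡⟨ [1+m]C[p]*[1+m∸p] m (≤-trans (m+n≤o⇒m≤o p p+c≤k) (m≤m+n k d)) ⟩
      N * (m C p)                     ≤⟨ *-monoʳ-≤ N (C-mono m (s≤s⁻¹ p<c) (≤-trans p+c≤k (m≤m+n k d))) ⟩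
      N * (m C c)                     ≡⟨ [1+j]*[1+m]C[1+j] m c ⟨
      suc c * (N C suc c)             ≡⟨ *-comm (suc c) _ ⟩
      (N C suc c) * suc c             ≡⟨ cong (λ z → (N C suc c) * (suc c ∸ z)) α≡0 ⟨
      (N C suc c) * (suc c ∸ α (suc c)) ∎
      where
      open ≤-Reasoning
      p+c≤k : p + c ≤ k
      p+c≤k = ≤-reflexive (suc-injective (trans (sym (+-suc p c)) p+c≡))

    -- At most one of the two charges is nonzero, so each is compared with `deficit c` separately.
    low+high≤deficit : ∀ p p′ c → p + c ≡ suc k → p′ + c ≡ N → low p + high p′ ≤ deficit c
    low+high≤deficit p p′ c p+c≡ p′+c≡ with low-or-high p
    ... | inj₂ (_ , low≡0 , _) = subst (_≤ deficit c) (cong (_+ high p′) (sym low≡0)) (high≤deficit p′ c p′+c≡)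
    ... | inj₁ (p+p≤n , low≡ , _) with α p ≤? p
    ...   | yes αp≤p = subst (_≤ deficit c) (cong (_+ high p′) (sym (trans low≡ (excess≡0 αp≤p)))) (high≤deficit p′ c p′+c≡)
    ...   | no αp≰p = subst (_≤ deficit c) (sym (trans (cong₂ _+_ low≡ high′≡0) (+-identityʳ _)))
                        (excess≤deficit p+c≡ p<c p<αp)
      where
      p<αp = ≰⇒> αp≰p
      -- `not-both` applied to `p` and itself. Then `p < c` follows from `2p ≤ k < p + c`.
      p+p≤k : p + p ≤ k
      p+p≤k = ≮⇒≥ λ k<p+p → not-both p<αp p<αp k<p+p p+p≤n
      p<c : p < c
      p<c = +-cancelˡ-< p p c (subst (p + p <_) (sym p+c≡) (s≤s p+p≤k))
      high′≡0 : high p′ ≡ 0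
      high′≡0 with low-or-high p′
      ... | inj₁ (_ , _ , high≡) = high≡
      -- `p < c ≤ p′` puts `p + p′` between `p + c = suc k` and `c + p′ = N`.
      ... | inj₂ (n<2p′ , _ , high≡) = trans high≡ (excess≡0 (≮⇒≥ λ p′< → not-both p<αp p′<
              (≤-trans (≤-reflexive (sym p+c≡)) (+-monoʳ-≤ p c≤p′))
              (≤-trans (+-monoˡ-≤ p′ (<⇒≤ p<c)) (≤-reflexive (trans (+-comm c p′) p′+c≡)))))
        where
        c≤p′ : c ≤ p′
        c≤p′ = <⇒≤ (+-cancelˡ-< p′ c p′ (subst (_< p′ + p′) (sym p′+c≡) n<2p′))

    -- The partners `N ∸ c` of `c = 1, …, k` run over `d + 1, …, d + k` instead of `1, …, k`. An
    -- index `p` lost in this way is at most both `k` and `d`, so `2p ≤ k + d` and it has no high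
    -- part.
    high-shift : ∑< k (λ i → high (suc i)) ≤ ∑< k (λ i → high (suc (i + d)))
    high-shift with ≤-total k d
    ... | inj₁ k≤d = subst (_≤ ∑< k (λ i → high (suc (i + d)))) (sym (∑-0 (downFrom k) λ {i} i∈ → high≡0 (suc i)
            (≤-trans (+-mono-≤ (∈-downFrom⁻ i∈) (≤-trans (∈-downFrom⁻ i∈) k≤d)) (n≤1+n m)))) z≤n
    ... | inj₂ d≤k = begin
      ∑< k h                                  ≡⟨ cong (λ z → ∑< z h) (m∸n+n≡m d≤k) ⟨
      ∑< (k ∸ d + d) h                        ≡⟨ ∑<-split d (k ∸ d) h ⟩
      ∑< (k ∸ d) (λ i → h (i + d)) + ∑< d h   ≡⟨ cong (∑< (k ∸ d) (λ i → h (i + d)) +_) (∑-0 (downFrom d) λ {i} i∈ →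
                                                   high≡0 (suc i) (≤-trans (+-mono-≤ (≤-trans (∈-downFrom⁻ i∈) d≤k) (∈-downFrom⁻ i∈)) (n≤1+n m))) ⟩
      ∑< (k ∸ d) (λ i → h (i + d)) + 0        ≡⟨ +-identityʳ _ ⟩
      ∑< (k ∸ d) (λ i → h (i + d))            ≤⟨ m≤n+m _ _ ⟩
      _ + ∑< (k ∸ d) (λ i → h (i + d))        ≡⟨ ∑<-split (k ∸ d) d (λ i → h (i + d)) ⟨
      ∑< (d + (k ∸ d)) (λ i → h (i + d))      ≡⟨ cong (λ z → ∑< z (λ i → h (i + d))) (m+[n∸m]≡n d≤k) ⟩
      ∑< k (λ i → h (i + d))                  ∎
      where
      open ≤-Reasoning
      h : ℕ → ℕ
      h i = high (suc i)

    ∑excess≤∑deficit : ∑< k (excess ∘ suc) ≤ ∑< k (deficit ∘ suc)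
    ∑excess≤∑deficit = begin
      ∑< k (excess ∘ suc)
        ≡⟨ ∑-cong (downFrom k) (λ {i} _ → low+high (suc i)) ⟩
      ∑< k (λ i → low (suc i) + high (suc i))
        ≡⟨ ∑-distrib-+ (downFrom k) _ _ ⟩
      ∑< k (low ∘ suc) + ∑< k (high ∘ suc)
        ≤⟨ +-monoʳ-≤ (∑< k (low ∘ suc)) high-shift ⟩
      ∑< k (low ∘ suc) + ∑< k (λ i → high (suc (i + d)))
        ≡⟨ ∑-distrib-+ (downFrom k) _ _ ⟨
      ∑< k (λ i → low (suc i) + high (suc (i + d)))
        -- After reversal the partners of `c = suc i` are `k ∸ i` and `k ∸ i + d`; adding `c` gives
        -- `suc k` and `N`.
        ≡⟨ ∑<-reverse k (λ i → low (suc i) + high (suc (i + d))) ⟩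
      ∑< k (λ i → low (suc (k ∸ suc i)) + high (suc (k ∸ suc i + d)))
        ≤⟨ ∑-mono (downFrom k) (λ {i} i∈ → low+high≤deficit (suc (k ∸ suc i)) (suc (k ∸ suc i + d)) (suc i)
             (cong suc (m∸n+n≡m (∈-downFrom⁻ i∈)))
             (cong suc (trans (solve 3 (λ a b c → a :+ b :+ c := a :+ c :+ b) refl (k ∸ suc i) d (suc i))
                              (cong (_+ d) (m∸n+n≡m (∈-downFrom⁻ i∈)))))) ⟩
      ∑< k (deficit ∘ suc) ∎
      where
      open ≤-Reasoning

  ∑-weighted : ∑< k (λ j → (N C suc j) * α (suc j)) ≤ N * binomSumBelow m k
  -- With the deficits added to both sides, `balance` trades `α p` for `p` at the price of the
  -- excess, and `absorb` evaluates the main term.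
  ∑-weighted = +-cancelʳ-≤ (∑< k (deficit ∘ suc)) _ _ (begin
    ∑< k (λ j → (N C suc j) * α (suc j)) + ∑< k (deficit ∘ suc)
      ≡⟨ ∑-distrib-+ (downFrom k) _ _ ⟨
    ∑< k (λ j → (N C suc j) * α (suc j) + deficit (suc j))
      ≡⟨ ∑-cong (downFrom k) (λ {j} _ → balance (suc j)) ⟩
    ∑< k (λ j → (N C suc j) * suc j + excess (suc j))
      ≡⟨ ∑-distrib-+ (downFrom k) _ _ ⟩
    ∑< k (λ j → (N C suc j) * suc j) + ∑< k (excess ∘ suc)
      ≤⟨ +-mono-≤ (≤-reflexive (absorb k)) ∑excess≤∑deficit ⟩
    N * binomSumBelow m k + ∑< k (deficit ∘ suc) ∎)
    where
    open ≤-Reasoning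
    balance : ∀ p → (N C p) * α p + deficit p ≡ (N C p) * p + excess p
    balance p = trans (sym (*-distribˡ-+ (N C p) (α p) _))
      (trans (cong ((N C p) *_) (m+[n∸m]≡n+[m∸n] (α p) p)) (*-distribˡ-+ (N C p) p _))
    absorb : ∀ k → ∑< k (λ j → (N C suc j) * suc j) ≡ N * binomSumBelow m k
    absorb zero    = sym (*-zeroʳ N)
    absorb (suc k) = trans (cong₂ _+_ (trans (*-comm (N C suc k) (suc k)) ([1+j]*[1+m]C[1+j] m k)) (absorb k))
                           (sym (*-distribˡ-+ N (m C k) _))

-- Numerical indicators, and inserting or removing a coordinate.

⟦_⟧ : Bool → ℕ
⟦ b ⟧ = if b then 1 else 0

⟦⟧≤1 : ∀ b → ⟦ b ⟧ ≤ 1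
⟦⟧≤1 true  = ≤-refl
⟦⟧≤1 false = z≤n

same : Bool → Bool → ℕ
same x y = ⟦ does (x Bool.≟ y) ⟧

-- Kronecker delta as a product over coordinates, so that single coordinates can be factored out of
-- sums.
δ : Vec Bool n → Vec Bool n → ℕ
δ []       []       = 1
δ (x ∷ xs) (y ∷ ys) = same x y * δ xs ys

δ≤1 : (p q : Vec Bool n) → δ p q ≤ 1
δ≤1 []       []       = ≤-refl
δ≤1 (x ∷ xs) (y ∷ ys) = *-mono-≤ (⟦⟧≤1 (does (x Bool.≟ y))) (δ≤1 xs ys)

δ-refl : (p : Vec Bool n) → δ p p ≡ 1
δ-refl []          = refl
δ-refl (true  ∷ p) = trans (*-identityˡ _) (δ-refl p)
δ-refl (false ∷ p) = trans (*-identityˡ _) (δ-refl p)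

δ>0⇒≡ : (p q : Vec Bool n) → 0 < δ p q → p ≡ q
δ>0⇒≡ []          []          _ = refl
δ>0⇒≡ (true  ∷ p) (true  ∷ q) h = cong (true ∷_) (δ>0⇒≡ p q (subst (0 <_) (*-identityˡ _) h))
δ>0⇒≡ (false ∷ p) (false ∷ q) h = cong (false ∷_) (δ>0⇒≡ p q (subst (0 <_) (*-identityˡ _) h))

-- The factor at coordinate `i` splits off. This separates where a code sends the head from what it
-- does to the tail.
δ-insertAt : (p : Vec Bool n) (i : Fin (suc n)) (x : Bool) (q : Vec Bool (suc n)) →
  δ (insertAt p i x) q ≡ same x (lookup q i) * δ p (removeAt q i)
δ-insertAt p       zero    x (y ∷ q)     = refl
δ-insertAt (z ∷ p) (suc i) x (y ∷ q@(_ ∷ _)) = trans (cong (same z y *_) (δ-insertAt p i x q))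
  (solve 3 (λ a b c → a :* (b :* c) := b :* (a :* c)) refl (same z y) (same x (lookup q i)) (δ p (removeAt q i)))

∣∷∣ : ∀ x (p : Subset n) → ∣ x ∷ p ∣ ≡ ⟦ x ⟧ + ∣ p ∣
∣∷∣ true  p = refl
∣∷∣ false p = refl

∣insertAt∣ : (p : Subset n) (i : Fin (suc n)) (x : Bool) → ∣ insertAt p i x ∣ ≡ ⟦ x ⟧ + ∣ p ∣
∣insertAt∣ p       zero    x = ∣∷∣ x p
∣insertAt∣ (y ∷ p) (suc i) x = begin
  ∣ y ∷ insertAt p i x ∣        ≡⟨ ∣∷∣ y (insertAt p i x) ⟩
  ⟦ y ⟧ + ∣ insertAt p i x ∣    ≡⟨ cong (⟦ y ⟧ +_) (∣insertAt∣ p i x) ⟩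
  ⟦ y ⟧ + (⟦ x ⟧ + ∣ p ∣)       ≡⟨ solve 3 (λ a b c → a :+ (b :+ c) := b :+ (a :+ c)) refl ⟦ y ⟧ ⟦ x ⟧ ∣ p ∣ ⟩
  ⟦ x ⟧ + (⟦ y ⟧ + ∣ p ∣)       ≡⟨ cong (⟦ x ⟧ +_) (∣∷∣ y p) ⟨
  ⟦ x ⟧ + ∣ y ∷ p ∣             ∎
  where
  open ≡-Reasoning

∣removeAt∣ : (q : Subset (suc n)) (i : Fin (suc n)) → ∣ q ∣ ≡ ⟦ lookup q i ⟧ + ∣ removeAt q i ∣
∣removeAt∣ q i = trans (cong ∣_∣ (sym (insertAt-removeAt q i))) (∣insertAt∣ (removeAt q i) i (lookup q i))

insertAt-∩ : (p q : Subset n) (i : Fin (suc n)) (x y : Bool) →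
  insertAt p i x ∩ insertAt q i y ≡ insertAt (p ∩ q) i (x ∧ y)
insertAt-∩ p       q       zero    x y = refl
insertAt-∩ (_ ∷ p) (_ ∷ q) (suc i) x y = cong (_ ∷_) (insertAt-∩ p q i x y)

-- Permutations and their action on subsets.

-- Lehmer codes: i ∷ π permutes the tail by π and then inserts the head at position i.
data Code : ℕ → Set where
  []  : Code 0
  _∷_ : Fin (suc n) → Code n → Code (suc n)

codes : ∀ n → List (Code n)
codes zero    = [] ∷ []
codes (suc n) = cartesianProductWith _∷_ (allFin (suc n)) (codes n)

act : Code n → Subset n → Subset n
act []      []      = []
act (i ∷ π) (x ∷ p) = insertAt (act π p) i x

∣act∣ : (π : Code n) (p : Subset n) → ∣ act π p ∣ ≡ ∣ p ∣
∣act∣ []      []      = refl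
∣act∣ (i ∷ π) (x ∷ p) = trans (∣insertAt∣ (act π p) i x) (trans (cong (⟦ x ⟧ +_) (∣act∣ π p)) (sym (∣∷∣ x p)))

act-∩ : (π : Code n) (p q : Subset n) → act π p ∩ act π q ≡ act π (p ∩ q)
act-∩ []      []      []      = refl
act-∩ (i ∷ π) (x ∷ p) (y ∷ q) = trans (insertAt-∩ (act π p) (act π q) i x y)
  (cong (λ z → insertAt z i (x ∧ y)) (act-∩ π p q))

act-injective : (π : Code n) {p q : Subset n} → act π p ≡ act π q → p ≡ q
act-injective []      {[]}    {[]}    _ = refl
act-injective (i ∷ π) {x ∷ p} {y ∷ q} e = cong₂ _∷_
  (trans (sym (insertAt-lookup (act π p) i x)) (trans (cong (λ v → lookup v i) e) (insertAt-lookup (act π q) i y)))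
  (act-injective π (trans (sym (removeAt-insertAt (act π p) i x))
    (trans (cong (λ v → removeAt v i) e) (removeAt-insertAt (act π q) i y))))

∑-allFin : ∀ n (f : Fin (suc n) → ℕ) → ∑ (allFin (suc n)) f ≡ f zero + ∑ (allFin n) (f ∘ suc)
∑-allFin n f = cong (λ z → f zero + sum z) (trans (map-tabulate suc f) (sym (map-tabulate id (f ∘ suc))))

∑-same-true : (q : Subset n) → ∑ (allFin n) (λ i → same true (lookup q i)) ≡ ∣ q ∣
∑-same-true []          = refl
∑-same-true {suc n} (true  ∷ q) = trans (∑-allFin n (λ i → same true (lookup (true ∷ q) i))) (cong suc (∑-same-true q))
∑-same-true {suc n} (false ∷ q) = trans (∑-allFin n (λ i → same true (lookup (false ∷ q) i))) (∑-same-true q)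

∑-same-false : (q : Subset n) → ∑ (allFin n) (λ i → same false (lookup q i)) ≡ n ∸ ∣ q ∣
∑-same-false []          = refl
∑-same-false {suc n} (true  ∷ q) = trans (∑-allFin n (λ i → same false (lookup (true ∷ q) i))) (∑-same-false q)
∑-same-false {suc n} (false ∷ q) = trans (∑-allFin n (λ i → same false (lookup (false ∷ q) i)))
  (trans (cong suc (∑-same-false q)) (sym (+-∸-assoc 1 (∣p∣≤n q))))

-- The head `x` must land on a position `i` where `q` also has `x`; the tail then faces the same
-- problem for `removeAt q i`. The number of such `i` extends the first factorial if `x` is `true`
-- and the second if it is `false`.
∑-act : (p q : Subset n) → ∣ p ∣ ≡ ∣ q ∣ → ∑ (codes n) (λ π → δ (act π p) q) ≡ ∣ q ∣ ! * (n ∸ ∣ q ∣) !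
∑-act []      []  _ = refl
∑-act {suc n} (x ∷ p) q ∣p∣≡∣q∣ = begin
  ∑ (codes (suc n)) (λ π → δ (act π (x ∷ p)) q)
    ≡⟨ ∑-cartesianProductWith _∷_ (allFin (suc n)) (codes n) _ ⟩
  ∑ (allFin (suc n)) (λ i → ∑ (codes n) (λ π → δ (insertAt (act π p) i x) q))
    ≡⟨ ∑-cong (allFin (suc n)) (λ {i} _ → at i) ⟩
  ∑ (allFin (suc n)) (λ i → (∣ p ∣ ! * (n ∸ ∣ p ∣) !) * same x (lookup q i))
    ≡⟨ *-distribˡ-∑ (allFin (suc n)) (∣ p ∣ ! * (n ∸ ∣ p ∣) !) (λ i → same x (lookup q i)) ⟨
  (∣ p ∣ ! * (n ∸ ∣ p ∣) !) * ∑ (allFin (suc n)) (λ i → same x (lookup q i))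
    ≡⟨ total x ∣p∣≡∣q∣ ⟩
  ∣ q ∣ ! * (suc n ∸ ∣ q ∣) ! ∎
  where
  open ≡-Reasoning
  step : ∀ i → same x (lookup q i) * ∑ (codes n) (λ π → δ (act π p) (removeAt q i))
             ≡ (∣ p ∣ ! * (n ∸ ∣ p ∣) !) * same x (lookup q i)
  step i with x Bool.≟ lookup q i
  ... | no _  = sym (*-zeroʳ (∣ p ∣ ! * (n ∸ ∣ p ∣) !))
  ... | yes x≡ = trans (*-identityˡ _) (trans (∑-act p (removeAt q i) ∣p∣≡)
          (trans (cong (λ z → z ! * (n ∸ z) !) (sym ∣p∣≡)) (sym (*-identityʳ _))))
    where
    ∣p∣≡ : ∣ p ∣ ≡ ∣ removeAt q i ∣
    ∣p∣≡ = +-cancelˡ-≡ ⟦ x ⟧ _ _ (trans (sym (∣∷∣ x p)) (trans ∣p∣≡∣q∣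
      (trans (∣removeAt∣ q i) (cong (λ z → ⟦ z ⟧ + ∣ removeAt q i ∣) (sym x≡)))))
  at : ∀ i → ∑ (codes n) (λ π → δ (insertAt (act π p) i x) q)
           ≡ (∣ p ∣ ! * (n ∸ ∣ p ∣) !) * same x (lookup q i)
  at i = trans (∑-cong (codes n) (λ {π} _ → δ-insertAt (act π p) i x q))
    (trans (sym (*-distribˡ-∑ (codes n) (same x (lookup q i)) _)) (step i))
  total : ∀ x → ∣ x ∷ p ∣ ≡ ∣ q ∣ → (∣ p ∣ ! * (n ∸ ∣ p ∣) !) * ∑ (allFin (suc n)) (λ i → same x (lookup q i))
                ≡ ∣ q ∣ ! * (suc n ∸ ∣ q ∣) !
  total true e = trans (cong ((∣ p ∣ ! * (n ∸ ∣ p ∣) !) *_) (trans (∑-same-true q) (sym e)))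
    (trans (solve 3 (λ a b c → a :* b :* c := c :* a :* b) refl (∣ p ∣ !) ((n ∸ ∣ p ∣) !) (suc ∣ p ∣))
           (cong (λ z → z ! * (suc n ∸ z) !) e))
  total false e = trans (cong ((∣ p ∣ ! * (n ∸ ∣ p ∣) !) *_) (trans (∑-same-false q) (trans (cong (suc n ∸_) (sym e)) (+-∸-assoc 1 (∣p∣≤n p)))))
    (trans (solve 3 (λ a b c → a :* b :* c := a :* (c :* b)) refl (∣ p ∣ !) ((n ∸ ∣ p ∣) !) (suc (n ∸ ∣ p ∣)))
      (trans (cong (λ z → ∣ p ∣ ! * z !) (sym (+-∸-assoc 1 (∣p∣≤n p)))) (cong (λ z → z ! * (suc n ∸ z) !) e)))

length-codes : ∀ n → length (codes n) ≡ n !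
length-codes zero    = refl
length-codes (suc n) = begin
  length (codes (suc n))
    ≡⟨ ∑-1 (codes (suc n)) ⟨
  ∑ (codes (suc n)) (λ _ → 1)
    ≡⟨ ∑-cartesianProductWith _∷_ (allFin (suc n)) (codes n) (λ _ → 1) ⟩
  ∑ (allFin (suc n)) (λ _ → ∑ (codes n) (λ _ → 1))
    ≡⟨ ∑-const (allFin (suc n)) (∑ (codes n) (λ _ → 1)) ⟩
  length (allFin (suc n)) * ∑ (codes n) (λ _ → 1)
    ≡⟨ cong (_* ∑ (codes n) (λ _ → 1)) (length-tabulate {n = suc n} id) ⟩
  suc n * ∑ (codes n) (λ _ → 1)
    ≡⟨ cong (suc n *_) (trans (∑-1 (codes n)) (length-codes n)) ⟩
  suc n * n ! ∎
  where
  open ≡-Reasoning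
  ∑-1 : (xs : List X) → ∑ xs (λ _ → 1) ≡ length xs
  ∑-1 xs = trans (∑-const xs 1) (*-identityʳ (length xs))

-- Arcs of the circle as subsets.

∣tabulate∣ : ∀ n (f : ℕ → Bool) → ∣ tabulate {n = n} (f ∘ toℕ) ∣ ≡ ∑< n (⟦_⟧ ∘ f)
∣tabulate∣ zero    f = refl
∣tabulate∣ (suc n) f = trans (∣∷∣ (f 0) (tabulate {n = n} (f ∘ suc ∘ toℕ))) (trans (cong (⟦ f 0 ⟧ +_) (∣tabulate∣ n (f ∘ suc))) (sym (∑<-bottom n (⟦_⟧ ∘ f))))

∣tabulate∩tabulate∣ : ∀ n (f g : Fin n → Bool) → (∀ i → f i ∧ g i ≡ false) → ∣ tabulate f ∩ tabulate g ∣ ≡ 0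
∣tabulate∩tabulate∣ zero    f g h = refl
∣tabulate∩tabulate∣ (suc n) f g h = trans (∣∷∣ (f zero ∧ g zero) (tabulate (f ∘ suc) ∩ tabulate (g ∘ suc)))
  (cong₂ _+_ (cong ⟦_⟧ (h zero)) (∣tabulate∩tabulate∣ n (f ∘ suc) (g ∘ suc) (h ∘ suc)))

module Arcs (m : ℕ) where

  private
    N : ℕ
    N = suc m

  -- arc a s consists of the a cyclically consecutive points starting at -s mod N.
  inArc : ℕ → ℕ → Bool
  inArc a y = y % N <ᵇ a

  arc : ℕ → ℕ → Subset N
  arc a s = tabulate (λ x → inArc a (toℕ x + s))

  private
    inArc-periodic : ∀ a y → inArc a (y + N) ≡ inArc a y
    inArc-periodic a y = cong (_<ᵇ a) ([m+n]%n≡m%n y N)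

  arc-periodic : ∀ a s → arc a (s + N) ≡ arc a s
  arc-periodic a s = tabulate-cong λ x →
    trans (cong (inArc a) (sym (+-assoc (toℕ x) s N))) (inArc-periodic a (toℕ x + s))

  ∑-<ᵇ : ∀ n a → a ≤ n → ∑< n (λ i → ⟦ i <ᵇ a ⟧) ≡ a
  ∑-<ᵇ zero    zero    _         = refl
  ∑-<ᵇ (suc n) zero    _         = ∑-<ᵇ n zero z≤n
  ∑-<ᵇ (suc n) (suc a) (s≤s a≤n) = trans (∑<-bottom n (λ i → ⟦ i <ᵇ suc a ⟧)) (cong suc (∑-<ᵇ n a a≤n))

  ∣arc∣ : ∀ {a} → a ≤ N → ∀ s → ∣ arc a s ∣ ≡ a
  ∣arc∣ {a} a≤N s = begin
    ∣ arc a s ∣                       ≡⟨ ∣tabulate∣ N (λ i → inArc a (i + s)) ⟩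
    ∑< N (λ i → ⟦ inArc a (i + s) ⟧)  ≡⟨ ∑<-window N (λ i → ⟦ inArc a i ⟧) (λ i → cong ⟦_⟧ (inArc-periodic a i)) s ⟩
    ∑< N (λ i → ⟦ inArc a i ⟧)        ≡⟨ ∑-cong (downFrom N) (λ i∈ → cong (λ z → ⟦ z <ᵇ a ⟧) (m<n⇒m%n≡m (∈-downFrom⁻ i∈))) ⟩
    ∑< N (λ i → ⟦ i <ᵇ a ⟧)           ≡⟨ ∑-<ᵇ N a a≤N ⟩
    a                                 ∎
    where open ≡-Reasoning

  -- If `y` has remainder `r < a`, then `r + c < N`, so the shift by `c` does not wrap around and
  -- leaves remainder `r + c ≥ b`.
  inArc-disjoint : ∀ {a b c} → b ≤ c → a + c ≤ N → ∀ y → inArc a y ∧ inArc b (y + c) ≡ false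
  inArc-disjoint {a} {b} {c} b≤c a+c≤N y
    with y % N <ᵇ a | <ᵇ-reflects-< (y % N) a | (y + c) % N <ᵇ b | <ᵇ-reflects-< ((y + c) % N) b
  ... | false | _        | _     | _       = refl
  ... | true  | _        | false | _       = refl
  ... | true  | ofʸ r<a  | true  | ofʸ r′<b = contradiction r′<b (≤⇒≯ (begin
    b                  ≤⟨ b≤c ⟩
    c                  ≤⟨ m≤n+m c _ ⟩
    y % N + c          ≡⟨ m<n⇒m%n≡m (≤-trans (+-monoˡ-< c r<a) a+c≤N) ⟨
    (y % N + c) % N    ≡⟨ lemma ⟩
    (y + c) % N        ∎))
    where
    open ≤-Reasoning
    lemma : (y % N + c) % N ≡ (y + c) % N
    lemma = trans (%-distribˡ-+ (y % N) c N)
      (trans (cong (λ z → (z + c % N) % N) (m%n%n≡m%n y N)) (sym (%-distribˡ-+ y c N)))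

  -- The second arc starts `c` places before the first; `b ≤ c` makes it end in time, and
  -- `a + c ≤ N` keeps the first from running round into it.
  ∣arc∩arc∣ : ∀ {a b c} → b ≤ c → a + c ≤ N → ∀ s → ∣ arc a s ∩ arc b (s + c) ∣ ≡ 0
  ∣arc∩arc∣ {a} {b} {c} b≤c a+c≤N s = ∣tabulate∩tabulate∣ N (λ x → inArc a (toℕ x + s)) (λ x → inArc b (toℕ x + (s + c))) λ x →
    trans (cong (λ z → inArc a (toℕ x + s) ∧ inArc b z) (sym (+-assoc (toℕ x) s c)))
          (inArc-disjoint b≤c a+c≤N (toℕ x + s))

-- Multiplicities and admissible families.

count : List (Subset n) → Subset n → ℕ
count G q = ∑ G (λ p → δ p q)

count>0⇒∈ : (G : List (Subset n)) {q : Subset n} → 0 < count G q → q ∈ G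
count>0⇒∈ G {q} h with ∑-positive G _ h
... | p , p∈G , δ>0 = subst (_∈ G) (δ>0⇒≡ p q δ>0) p∈G

count≤1 : (G : List (Subset n)) → Unique G → ∀ q → count G q ≤ 1
count≤1 []      _          q = z≤n
count≤1 (p ∷ G) (p∉G ∷ uG) q with n≡0⊎n>0 {δ p q}
... | inj₁ δ≡0 = subst (λ z → z + count G q ≤ 1) (sym δ≡0) (count≤1 G uG q)
... | inj₂ δ>0 with n≡0⊎n>0 {count G q}
...   | inj₁ c≡0 = subst (λ z → δ p q + z ≤ 1) (sym c≡0) (subst (_≤ 1) (sym (+-identityʳ _)) (δ≤1 p q))
...   | inj₂ c>0 = contradiction (δ>0⇒≡ p q δ>0) (All.lookup p∉G (count>0⇒∈ G c>0))

-- Nonemptiness and disjointness are phrased by cardinalities, which `act` preserves.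
record Admissible (k : ℕ) (G : List (Subset n)) : Set where
  field
    unique   : Unique G
    size≤k   : ∀ {p} → p ∈ G → ∣ p ∣ ≤ k
    size>0   : ∀ {p} → p ∈ G → 0 < ∣ p ∣
    disjoint : ∀ {p q} → p ∈ G → q ∈ G → ∣ p ∩ q ∣ ≡ 0 → ∣ p ∣ + ∣ q ∣ ≤ k

-- Relabelling the family stands in for relabelling the circle, so the arcs of one fixed cyclic
-- order suffice.
act-admissible : ∀ {k} {F : List (Subset n)} (π : Code n) → Admissible k F → Admissible k (map (act π) F)
act-admissible {k = k} π adm = record
  { unique   = Unique.map⁺ (act-injective π) unique
  ; size≤k   = λ p∈ → size≤k′ (∈-map⁻ (act π) p∈)
  ; size>0   = λ p∈ → size>0′ (∈-map⁻ (act π) p∈)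
  ; disjoint = λ p∈ q∈ → disjoint′ (∈-map⁻ (act π) p∈) (∈-map⁻ (act π) q∈)
  }
  where
  open Admissible adm
  size≤k′ : ∀ {p} → ∃ (λ r → r ∈ _ × p ≡ act π r) → ∣ p ∣ ≤ k
  size≤k′ (r , r∈ , refl) = subst (_≤ k) (sym (∣act∣ π r)) (size≤k r∈)
  size>0′ : ∀ {p} → ∃ (λ r → r ∈ _ × p ≡ act π r) → 0 < ∣ p ∣
  size>0′ (r , r∈ , refl) = subst (0 <_) (sym (∣act∣ π r)) (size>0 r∈)
  disjoint′ : ∀ {p q} → ∃ (λ r → r ∈ _ × p ≡ act π r) → ∃ (λ r → r ∈ _ × q ≡ act π r) →
    ∣ p ∩ q ∣ ≡ 0 → ∣ p ∣ + ∣ q ∣ ≤ k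
  disjoint′ (r , r∈ , refl) (t , t∈ , refl) e = subst (_≤ k) (sym (cong₂ _+_ (∣act∣ π r) (∣act∣ π t)))
    (disjoint r∈ t∈ (trans (sym (∣act∣ π (r ∩ t))) (trans (cong ∣_∣ (sym (act-∩ π r t))) e)))

∑<-≤n : ∀ n {f : ℕ → ℕ} → (∀ i → f i ≤ 1) → ∑< n f ≤ n
∑<-≤n zero    f≤1 = z≤n
∑<-≤n (suc n) f≤1 = +-mono-≤ (f≤1 n) (∑<-≤n n f≤1)

-- Averaging over all codes.

module _ (n k : ℕ) (arc : ℕ → ℕ → Subset n) where

  -- The weight offsets the number of codes carrying `p` onto a given arc, which depends on `∣ p ∣`.
  hits : Subset n → ℕ
  hits p = ∑< n (λ s → (n C ∣ p ∣) * δ p (arc ∣ p ∣ s))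

  -- Regrouping by arc length: a member of size `suc j` has `j < k`, so its hits are the term `j` of
  -- the sum over lengths.
  ∑-hits : {G : List (Subset n)} → Admissible k G →
    ∑ G hits ≤ ∑< k (λ j → (n C suc j) * ∑< n (λ s → count G (arc (suc j) s)))
  ∑-hits {G} adm = begin
    ∑ G hits
      ≤⟨ ∑-mono G (λ p∈G → ∑-mono (downFrom n) (λ {s} _ → own-level s p∈G)) ⟩
    ∑ G (λ p → ∑< n (λ s → ∑< k (λ j → hit p s j)))
      ≡⟨ ∑-cong G (λ {p} _ → ∑-comm (downFrom n) (downFrom k) (hit p)) ⟩
    ∑ G (λ p → ∑< k (λ j → ∑< n (λ s → hit p s j)))
      ≡⟨ ∑-comm G (downFrom k) (λ p j → ∑< n (λ s → hit p s j)) ⟩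
    ∑< k (λ j → ∑ G (λ p → ∑< n (λ s → hit p s j)))
      ≡⟨ ∑-cong (downFrom k) (λ {j} _ → ∑-comm G (downFrom n) (λ p s → hit p s j)) ⟩
    ∑< k (λ j → ∑< n (λ s → ∑ G (λ p → hit p s j)))
      ≡⟨ ∑-cong (downFrom k) (λ {j} _ → trans
           (∑-cong (downFrom n) (λ {s} _ → sym (*-distribˡ-∑ G (n C suc j) (λ p → δ p (arc (suc j) s)))))
           (sym (*-distribˡ-∑ (downFrom n) (n C suc j) (λ s → count G (arc (suc j) s))))) ⟩
    ∑< k (λ j → (n C suc j) * ∑< n (λ s → count G (arc (suc j) s))) ∎
    where
    open ≤-Reasoning
    open Admissible adm
    hit : Subset n → ℕ → ℕ → ℕ
    hit p s j = (n C suc j) * δ p (arc (suc j) s)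
    own-level : ∀ {p} s → p ∈ G → (n C ∣ p ∣) * δ p (arc ∣ p ∣ s) ≤ ∑< k (hit p s)
    own-level {p} s p∈G with ∣ p ∣ | size>0 p∈G | size≤k p∈G
    ... | suc j | _ | j<k = ∑-term (downFrom k) (hit p s) (∈-downFrom⁺ j<k)

  module _ (∣arc∣ : ∀ {a} → a ≤ n → ∀ s → ∣ arc a s ∣ ≡ a) where

    -- By `∑-act`, `a ! * (n ∸ a) !` codes carry `p` onto the arc starting at a given place; the
    -- weight completes this to `n !`, whatever the size of `p`.
    ∑-codes-hits : ∀ p → ∑ (codes n) (λ π → hits (act π p)) ≡ n * n !
    ∑-codes-hits p = begin
      ∑ (codes n) (λ π → hits (act π p))
        ≡⟨ ∑-cong (codes n) (λ {π} _ → cong (λ z → ∑< n (λ s → (n C z) * δ (act π p) (arc z s))) (∣act∣ π p)) ⟩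
      ∑ (codes n) (λ π → ∑< n (λ s → (n C a) * δ (act π p) (arc a s)))
        ≡⟨ ∑-comm (codes n) (downFrom n) (λ π s → (n C a) * δ (act π p) (arc a s)) ⟩
      ∑< n (λ s → ∑ (codes n) (λ π → (n C a) * δ (act π p) (arc a s)))
        ≡⟨ ∑-cong (downFrom n) (λ {s} _ → at s) ⟩
      ∑< n (λ s → n !)
        ≡⟨ ∑-const (downFrom n) (n !) ⟩
      length (downFrom n) * n !
        ≡⟨ cong (_* n !) (length-downFrom n) ⟩
      n * n ! ∎
      where
      open ≡-Reasoning
      a = ∣ p ∣
      at : ∀ s → ∑ (codes n) (λ π → (n C a) * δ (act π p) (arc a s)) ≡ n !
      at s = begin
        ∑ (codes n) (λ π → (n C a) * δ (act π p) (arc a s))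
          ≡⟨ *-distribˡ-∑ (codes n) (n C a) (λ π → δ (act π p) (arc a s)) ⟨
        (n C a) * ∑ (codes n) (λ π → δ (act π p) (arc a s))
          ≡⟨ cong ((n C a) *_) (∑-act p (arc a s) (sym size)) ⟩
        (n C a) * (∣ arc a s ∣ ! * (n ∸ ∣ arc a s ∣) !)
          ≡⟨ cong (λ z → (n C a) * (z ! * (n ∸ z) !)) size ⟩
        (n C a) * (a ! * (n ∸ a) !)
          ≡⟨ nCk*k![n∸k]!≡n! (∣p∣≤n p) ⟩
        n ! ∎
        where
        size : ∣ arc a s ∣ ≡ a
        size = ∣arc∣ (∣p∣≤n p) s

    -- Double counting over members and codes. The bound is asked of every admissible `G` because
    -- each code replaces `F` by its image.
    average : .{{_ : NonZero n}} (b : ℕ) → (∀ {G} → Admissible k G → ∑ G hits ≤ n * b) →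
      {F : List (Subset n)} → Admissible k F → length F ≤ b
    average b bound {F} adm = *-cancelʳ-≤ (length F) b (n * n !) (begin
      length F * (n * n !)
        ≡⟨ ∑-const F (n * n !) ⟨
      ∑ F (λ p → n * n !)
        ≡⟨ ∑-cong F (λ {p} _ → ∑-codes-hits p) ⟨
      ∑ F (λ p → ∑ (codes n) (λ π → hits (act π p)))
        ≡⟨ ∑-comm F (codes n) (λ p π → hits (act π p)) ⟩
      ∑ (codes n) (λ π → ∑ F (λ p → hits (act π p)))
        ≡⟨ ∑-cong (codes n) (λ {π} _ → ∑-map F (act π) hits) ⟨
      ∑ (codes n) (λ π → ∑ (map (act π) F) hits)
        ≤⟨ ∑-mono (codes n) (λ {π} _ → bound (act-admissible π adm)) ⟩
      ∑ (codes n) (λ _ → n * b)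
        ≡⟨ ∑-const (codes n) (n * b) ⟩
      length (codes n) * (n * b)
        ≡⟨ cong (_* (n * b)) (length-codes n) ⟩
      n ! * (n * b)
        ≡⟨ solve 3 (λ x y z → x :* (y :* z) := z :* (y :* x)) refl (n !) n b ⟩
      b * (n * n !) ∎)
      where
      open ≤-Reasoning
      instance
        _ = n !≢0
        _ = m*n≢0 n (n !)

-- Arc counts of an admissible family.

module _ (k d : ℕ) where
  private
    m N : ℕ
    m = k + d
    N = suc m
  open Arcs m

  arcCount : List (Subset N) → ℕ → ℕ
  arcCount G a = ∑< N (λ s → count G (arc a s))

  module _ {G : List (Subset N)} (adm : Admissible k G) where
    open Admissible adm

    private
      f : ℕ → ℕ → ℕ
      f a s = count G (arc a s)

      f≤1 : ∀ a s → f a s ≤ 1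
      f≤1 a s = count≤1 G unique (arc a s)

      f-periodic : ∀ a s → f a (s + N) ≡ f a s
      f-periodic a s = cong (count G) (arc-periodic a s)

      -- Otherwise both arcs would be disjoint members with sizes adding up to more than `k`.
      exclusion : ∀ {a b c} → k < a + b → b ≤ c → a + c ≤ N → ∀ s → 0 < f a s → f b (s + c) ≡ 0
      exclusion {a} {b} {c} k<a+b b≤c a+c≤N s fa>0 with n≡0⊎n>0 {f b (s + c)}
      ... | inj₁ fb≡0 = fb≡0
      ... | inj₂ fb>0 = contradiction k<a+b (≤⇒≯ (subst (_≤ k)
            (cong₂ _+_ (∣arc∣ (m+n≤o⇒m≤o a a+c≤N) s) (∣arc∣ (≤-trans b≤c (m+n≤o⇒n≤o a a+c≤N)) (s + c)))
            (disjoint (count>0⇒∈ G fa>0) (count>0⇒∈ G fb>0) (∣arc∩arc∣ b≤c a+c≤N s))))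

      module _ (a b : ℕ) (k<a+b : k < a + b) (a+b≤N : a + b ≤ N) where
        -- At offset `s + b` the arc of length `b` ends just before the arc of length `a` at `s`.
        -- The excluded offsets `b, …, N ∸ a` thus become `0, …, N ∸ (a + b)`, the form required by
        -- `crossing`.
        shifted : ℕ → ℕ
        shifted s = f b (s + b)

        shifted-periodic : ∀ s → shifted (s + N) ≡ shifted s
        shifted-periodic s = trans
          (cong (f b) (solve 3 (λ x y z → x :+ y :+ z := x :+ z :+ y) refl s N b)) (f-periodic b (s + b))

        shifted-excluded : ∀ s i → i ≤ N ∸ (a + b) → 0 < f a s → shifted (i + s) ≡ 0
        shifted-excluded s i i≤gap fa>0 = trans
          (cong (f b) (solve 3 (λ x y z → x :+ y :+ z := y :+ (z :+ x)) refl i s b))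
          (exclusion {a} {b} {b + i} k<a+b (m≤m+n b i)
            (subst (_≤ N) (+-assoc a b i) (subst (a + b + i ≤_) (m+[n∸m]≡n a+b≤N) (+-monoʳ-≤ (a + b) i≤gap))) s fa>0)

        ∑-shifted : ∑< N shifted ≡ arcCount G b
        ∑-shifted = ∑<-window N (f b) (f-periodic b) b

        cross : arcCount G a ≡ 0 ⊎ arcCount G b ≡ 0 ⊎ arcCount G a + arcCount G b ≤ a + b
        cross = subst (λ z → arcCount G a ≡ 0 ⊎ z ≡ 0 ⊎ arcCount G a + z ≤ a + b) ∑-shifted
          (crossing {N} {N ∸ (a + b)} {a + b} (m+[n∸m]≡n a+b≤N) (f a) shifted (f≤1 a) (λ s → f≤1 b (s + b))
                    (f-periodic a) shifted-periodic shifted-excluded)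

        -- `f+g≤1` summed once around the circle.
        compl : arcCount G a + arcCount G b ≤ N
        compl = subst (_≤ N) (trans (∑-distrib-+ (downFrom N) (f a) shifted) (cong (arcCount G a +_) ∑-shifted))
          (∑<-≤n N (f+g≤1 {N} {N ∸ (a + b)} {a + b} (m+[n∸m]≡n a+b≤N) (f a) shifted (f≤1 a) (λ s → f≤1 b (s + b))
                    (f-periodic a) shifted-periodic shifted-excluded))

    ∑-arcCount : ∑< k (λ j → (N C suc j) * arcCount G (suc j)) ≤ N * binomSumBelow m k
    ∑-arcCount = Circle.∑-weighted k d (arcCount G) cross
      (λ a b a+b≡N → subst (arcCount G a + arcCount G b ≤_) (sym a+b≡N)
        (compl a b (subst (k <_) (sym a+b≡N) (s≤s (m≤m+n k d))) (≤-reflexive a+b≡N)))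
      (λ a → ∑<-≤n N (f≤1 a))

  admissible-bound : {F : List (Subset N)} → Admissible k F → length F ≤ binomSumBelow m k
  admissible-bound = average N k arc ∣arc∣ (binomSumBelow m k)
    (λ {G} adm → ≤-trans (∑-hits N k arc {G} adm) (∑-arcCount {G} adm))

-- From the stated hypotheses to admissibility.

∈⇒∣p∣>0 : {p : Subset n} {x : Fin n} → p [ x ]= true → 0 < ∣ p ∣
∈⇒∣p∣>0 {p = true ∷ p}  here      = z<s
∈⇒∣p∣>0 {p = y ∷ p} (there x∈p) = subst (0 <_) (sym (∣∷∣ y p)) (≤-trans (∈⇒∣p∣>0 x∈p) (m≤n+m _ ⟦ y ⟧))

theorem3p1 : (n k : ℕ) → 1 ≤ k → k ≤ n ∸ 1 → (F : List (Subset n)) → Unique F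
    → All (λ A → ∣ A ∣ ≤ k) F
    → All Nonempty F
    → (∀ {A B} → A ∈ F → B ∈ F → Empty (A ∩ B) → ∣ A ∣ + ∣ B ∣ ≤ k)
    → length F ≤ binomSumBelow (n ∸ 1) k
theorem3p1 zero    _ 1≤k k≤0 = contradiction (≤-trans 1≤k k≤0) λ ()
theorem3p1 (suc m) k _ k≤m F unique sizes nonempty cross with m ∸ k | m+[n∸m]≡n k≤m
-- The slack `m ∸ k` becomes the variable `d` and `m` becomes `k + d`, as in `admissible-bound`.
... | d | refl = admissible-bound k d (record
  { unique   = unique
  ; size≤k   = All.lookup sizes
  ; size>0   = λ A∈F → ∈⇒∣p∣>0 (proj₂ (All.lookup nonempty A∈F))
  ; disjoint = λ A∈F B∈F ∣A∩B∣≡0 → cross A∈F B∈F (λ x∈ → <⇒≢ (∈⇒∣p∣>0 (proj₂ x∈)) (sym ∣A∩B∣≡0))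
  })
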